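{- Let $n \geq k \geq t$ and $r$ be positive integers. Every minimum $(n,k,t,r)$-graph is a disjoint union of cliques.
   Context: A graph $G$ is an $(n,k,t)$-graph if $|V(G)| = n$ and every induced subgraph of $G$ on $k$ vertices contains a clique on $t$ vertices. A graph $G$ is an $(n,k,t,r)$-graph if it is an $(n,k,t)$-graph and its independence number satisfies $\alpha(G) = r$. A minimum $(n,k,t,r)$-graph is an $(n,k,t,r)$-graph with the minimum number of edges among all $(n,k,t,r)$-graphs. "Disjoint union" means vertex-disjoint union, and a disjoint union of cliques may include cliques on one vertex. -}

module Defs where

open import Data.Nat using (ℕ; zero; suc; _+_; _≤_; _<?_)
open import Data.Fin using (Fin; zero; suc; toℕ)
open import Data.Fin.Subset using (Subset; _∈_; _⊆_; ∣_∣)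
open import Data.Bool using (Bool; true; false)
open import Data.Product using (Σ; _×_; ∃; ∃-syntax)
open import Relation.Binary.PropositionalEquality using (_≡_; _≢_)
open import Relation.Nullary.Decidable using (⌊_⌋)
open import Data.Bool using (_∧_)
open import Function.Bundles using (_⇔_)

record Graph (n : ℕ) : Set where
  field
    adj   : Fin n → Fin n → Bool
    sym   : ∀ u v → adj u v ≡ adj v u
    irrefl : ∀ u → adj u u ≡ false
open Graph public

Σᶠ : ∀ {m} → (Fin m → ℕ) → ℕ
Σᶠ {zero}  f = 0
Σᶠ {suc m} f = f zero + Σᶠ (λ i → f (suc i))

b2n : Bool → ℕ
b2n true  = 1
b2n false = 0

edges : ∀ {n} → Graph n → ℕ
edges G = Σᶠ (λ u → Σᶠ (λ v → b2n (⌊ toℕ u <? toℕ v ⌋ ∧ adj G u v)))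

IsClique : ∀ {n} → Graph n → Subset n → Set
IsClique G T = ∀ u v → u ∈ T → v ∈ T → u ≢ v → adj G u v ≡ true

IsIndependent : ∀ {n} → Graph n → Subset n → Set
IsIndependent G T = ∀ u v → u ∈ T → v ∈ T → adj G u v ≡ false

IsNKT : ∀ {n} → Graph n → ℕ → ℕ → Set
IsNKT {n} G k t = ∀ (S : Subset n) → ∣ S ∣ ≡ k →
  ∃[ T ] (T ⊆ S × ∣ T ∣ ≡ t × IsClique G T)

IndependenceNumber : ∀ {n} → Graph n → ℕ → Set
IndependenceNumber {n} G r =
  (∃[ I ] (IsIndependent G I × ∣ I ∣ ≡ r)) ×
  (∀ (I : Subset n) → IsIndependent G I → ∣ I ∣ ≤ r)

IsNKTR : ∀ {n} → Graph n → ℕ → ℕ → ℕ → Set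
IsNKTR G k t r = IsNKT G k t × IndependenceNumber G r

IsMinNKTR : ∀ {n} → Graph n → ℕ → ℕ → ℕ → Set
IsMinNKTR {n} G k t r =
  IsNKTR G k t r × (∀ (H : Graph n) → IsNKTR H k t r → edges G ≤ edges H)

-- vertex-disjoint union of cliques: a labelling of vertices by clique index
-- such that distinct vertices are adjacent iff they lie in the same clique
IsDisjointUnionOfCliques : ∀ {n} → Graph n → Set
IsDisjointUnionOfCliques {n} G =
  Σ (Fin n → Fin n) λ c → ∀ u v → u ≢ v → (adj G u v ≡ true ⇔ c u ≡ c v)

{-# OPTIONS --safe #-}

-- Peel off a maximum independent set J = L₀ of G, then a maximum independent
-- set L₁ of the rest, and so on, and let ℓ u be the index of the layer of u.
-- By maximality u has a neighbour in each of the ℓ u lower layers, so G has at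
-- least Σ ℓ u edges.  The layers shrink, so joining the vertices of equal rank
-- in their layers gives a disjoint union H of r cliques with exactly Σ ℓ u
-- edges.  A K_t-free set in H injects into L₀ ∪ … ∪ L_{t-2}, which is K_t-free
-- in G, so H is again an (n,k,t,r)-graph.  Hence in a minimum G every vertex
-- outside a maximum independent set J has exactly one neighbour in J.
-- Exchanging a vertex of J for a neighbour then rules out induced paths on
-- three vertices: adjacency is transitive.

module Submission where

open import Defs
open import Algebra.Properties.CommutativeSemigroup using (interchange)
open import Data.Nat using (ℕ; zero; suc; _+_; _∸_; _≤_; _<_; z≤n; s≤s; _≟_; _<?_; _≤?_)
open import Data.Nat.Properties hiding (_≟_; _<?_; _≤?_)
open import Data.Fin using (Fin; zero; suc; toℕ; fromℕ<)
open import Data.Fin.Properties using (any?; all?; toℕ<n; toℕ-injective; toℕ-fromℕ<) renaming (_≟_ to _≟ᶠ_; suc-injective to sucᶠ-injective)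
open import Data.Fin.Subset using (Subset; _∈_; ∣_∣)
open import Data.Fin.Subset.Properties using (anySubset?)
open import Data.Bool using (Bool; true; false; _∧_; _∨_; not) renaming (_≟_ to _≟ᵇ_)
open import Data.Bool.Properties using (∧-zeroʳ)
open import Data.Vec using ([]; _∷_; lookup; tabulate)
open import Data.Vec.Properties using (lookup∘tabulate; lookup⇒[]=; []=⇒lookup)
open import Data.Product using (∃; ∃-syntax; _×_; _,_; proj₁; proj₂)
open import Data.Sum using (_⊎_; inj₁; inj₂)
open import Function using (_∘_)
open import Function.Bundles using (mk⇔)
open import Relation.Binary using (tri<; tri≈; tri>)
open import Relation.Binary.PropositionalEquality using (_≡_; _≢_; refl; trans; cong; cong₂; subst; module ≡-Reasoning) renaming (sym to ≡-sym)
open import Relation.Nullary using (¬_; Dec; yes; no; contradiction)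
open import Relation.Nullary.Decidable using (⌊_⌋; _×-dec_; _⊎-dec_; _→-dec_)

-- Booleans

isYes⁺ : ∀ {a} {A : Set a} (d : Dec A) → A → ⌊ d ⌋ ≡ true
isYes⁺ (yes _) _ = refl
isYes⁺ (no ¬a) a = contradiction a ¬a

isYes⁻ : ∀ {a} {A : Set a} (d : Dec A) → ⌊ d ⌋ ≡ true → A
isYes⁻ (yes a) _ = a

isNo⁺ : ∀ {a} {A : Set a} (d : Dec A) → ¬ A → ⌊ d ⌋ ≡ false
isNo⁺ (yes a) ¬a = contradiction a ¬a
isNo⁺ (no _)  _  = refl

∧⁺ : ∀ {a b} → a ≡ true → b ≡ true → a ∧ b ≡ true
∧⁺ refl refl = refl

∧⁻ : ∀ {a b} → a ∧ b ≡ true → a ≡ true × b ≡ true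
∧⁻ {true} {true} _ = refl , refl

true≢false : ∀ {b} → b ≡ true → b ≢ false
true≢false refl ()

not-true⇒false : ∀ {b} → b ≢ true → b ≡ false
not-true⇒false {true}  b≢ = contradiction refl b≢
not-true⇒false {false} _  = refl

b2n-mono : ∀ {a b} → (a ≡ true → b ≡ true) → b2n a ≤ b2n b
b2n-mono {false}        _ = z≤n
b2n-mono {true} {true}  _ = ≤-refl
b2n-mono {true} {false} h = contradiction (h refl) λ ()

-- Finite sums

Σᶠ-cong : ∀ {m} {f g : Fin m → ℕ} → (∀ i → f i ≡ g i) → Σᶠ f ≡ Σᶠ g
Σᶠ-cong {zero}  h = refl
Σᶠ-cong {suc m} h = cong₂ _+_ (h zero) (Σᶠ-cong (h ∘ suc))

Σᶠ-mono-≤ : ∀ {m} {f g : Fin m → ℕ} → (∀ i → f i ≤ g i) → Σᶠ f ≤ Σᶠ g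
Σᶠ-mono-≤ {zero}  h = z≤n
Σᶠ-mono-≤ {suc m} h = +-mono-≤ (h zero) (Σᶠ-mono-≤ (h ∘ suc))

Σᶠ-mono-< : ∀ {m} {f g : Fin m → ℕ} → (∀ i → f i ≤ g i) → ∀ i → f i < g i → Σᶠ f < Σᶠ g
Σᶠ-mono-< h zero    f<g = +-mono-<-≤ f<g (Σᶠ-mono-≤ (h ∘ suc))
Σᶠ-mono-< h (suc i) f<g = +-mono-≤-< (h zero) (Σᶠ-mono-< (h ∘ suc) i f<g)

Σᶠ-zero : ∀ m → Σᶠ {m} (λ _ → 0) ≡ 0
Σᶠ-zero zero    = refl
Σᶠ-zero (suc m) = Σᶠ-zero m

Σᶠ-one : ∀ m → Σᶠ {m} (λ _ → 1) ≡ m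
Σᶠ-one zero    = refl
Σᶠ-one (suc m) = cong suc (Σᶠ-one m)

Σᶠ-≤1 : ∀ {m} {f : Fin m → ℕ} → (∀ i → f i ≤ 1) → Σᶠ f ≤ m
Σᶠ-≤1 {m} {f} h = subst (Σᶠ f ≤_) (Σᶠ-one m) (Σᶠ-mono-≤ h)

Σᶠ-≥1 : ∀ {m} {f : Fin m → ℕ} → (∀ i → 1 ≤ f i) → m ≤ Σᶠ f
Σᶠ-≥1 {m} {f} h = subst (_≤ Σᶠ f) (Σᶠ-one m) (Σᶠ-mono-≤ h)

Σᶠ-+ : ∀ {m} (f g : Fin m → ℕ) → Σᶠ (λ i → f i + g i) ≡ Σᶠ f + Σᶠ g
Σᶠ-+ {zero}  f g = refl
Σᶠ-+ {suc m} f g =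
  trans (cong (f zero + g zero +_) (Σᶠ-+ (f ∘ suc) (g ∘ suc)))
        (interchange +-commutativeSemigroup (f zero) (g zero) _ _)

Σᶠ-swap : ∀ {l m} (f : Fin l → Fin m → ℕ) →
  Σᶠ (λ i → Σᶠ (f i)) ≡ Σᶠ (λ j → Σᶠ (λ i → f i j))
Σᶠ-swap {zero}  {m} f = ≡-sym (Σᶠ-zero m)
Σᶠ-swap {suc l} f =
  trans (cong (Σᶠ (f zero) +_) (Σᶠ-swap (f ∘ suc)))
        (≡-sym (Σᶠ-+ (f zero) (λ j → Σᶠ (λ i → f (suc i) j))))

-- Counting

cnt : ∀ {n} → (Fin n → Bool) → ℕ
cnt p = Σᶠ (b2n ∘ p)

cnt-mono : ∀ {n} {p q : Fin n → Bool} → (∀ u → p u ≡ true → q u ≡ true) → cnt p ≤ cnt q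
cnt-mono h = Σᶠ-mono-≤ λ u → b2n-mono (h u)

cnt-empty : ∀ {n} {p : Fin n → Bool} → (∀ u → p u ≢ true) → cnt p ≡ 0
cnt-empty {n} h = trans (Σᶠ-cong λ u → cong b2n (not-true⇒false (h u))) (Σᶠ-zero n)

cnt-≥1 : ∀ {n} {p : Fin n → Bool} u → p u ≡ true → 1 ≤ cnt p
cnt-≥1 zero    pu rewrite pu = s≤s z≤n
cnt-≥1 {p = p} (suc u) pu = ≤-trans (cnt-≥1 {p = p ∘ suc} u pu) (m≤n+m _ _)

cnt-≥2 : ∀ {n} {p : Fin n → Bool} u v → u ≢ v → p u ≡ true → p v ≡ true → 2 ≤ cnt p
cnt-≥2 zero zero u≢v _ _ = contradiction refl u≢v
cnt-≥2 {p = p} zero (suc v) _ pu pv rewrite pu = s≤s (cnt-≥1 {p = p ∘ suc} v pv)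
cnt-≥2 {p = p} (suc u) zero _ pu pv rewrite pv = s≤s (cnt-≥1 {p = p ∘ suc} u pu)
cnt-≥2 {p = p} (suc u) (suc v) u≢v pu pv =
  ≤-trans (cnt-≥2 {p = p ∘ suc} u v (u≢v ∘ cong suc) pu pv) (m≤n+m _ _)

cnt-≤1 : ∀ {n} {p : Fin n → Bool} → (∀ u v → p u ≡ true → p v ≡ true → u ≡ v) → cnt p ≤ 1
cnt-≤1 {zero} _ = z≤n
cnt-≤1 {suc n} {p} h with p zero in p0
... | false = cnt-≤1 λ u v pu pv → sucᶠ-injective (h (suc u) (suc v) pu pv)
... | true  = s≤s (≤-reflexive (cnt-empty λ u pu → contradiction (h zero (suc u) p0 pu) λ ()))

cnt-disjoint : ∀ {n} {p q s : Fin n → Bool} → (∀ u → b2n (s u) ≡ b2n (p u) + b2n (q u)) →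
  cnt s ≡ cnt p + cnt q
cnt-disjoint {p = p} {q} h = trans (Σᶠ-cong h) (Σᶠ-+ (b2n ∘ p) (b2n ∘ q))

cnt-shrink : ∀ {n} (p : Fin n → Bool) k → k ≤ cnt p →
  ∃[ q ] (∀ u → q u ≡ true → p u ≡ true) × cnt q ≡ k
cnt-shrink {n} p zero _ = (λ _ → false) , (λ _ ()) , Σᶠ-zero n
cnt-shrink {zero} p (suc k) ()
cnt-shrink {suc n} p (suc k) k≤ with p zero in p0
... | true = let q , q⊆p , q≡k = cnt-shrink (p ∘ suc) k (≤-pred k≤) in
  (λ { zero → true ; (suc u) → q u }) ,
  (λ { zero _ → p0 ; (suc u) → q⊆p u }) , cong suc q≡k
... | false = let q , q⊆p , q≡k = cnt-shrink (p ∘ suc) (suc k) k≤ in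
  (λ { zero → false ; (suc u) → q u }) ,
  (λ { zero () ; (suc u) → q⊆p u }) , q≡k

Σᶠ-indicator : ∀ m a b → (b ≡ true → a < m) →
  Σᶠ {m} (λ j → b2n (⌊ a ≟ toℕ j ⌋ ∧ b)) ≡ b2n b
Σᶠ-indicator m a false _ =
  trans (Σᶠ-cong {m} λ j → cong b2n (∧-zeroʳ ⌊ a ≟ toℕ j ⌋)) (Σᶠ-zero m)
Σᶠ-indicator zero a true a<m = contradiction (a<m refl) λ ()
Σᶠ-indicator (suc m) zero true _ = cong suc (Σᶠ-zero m)
Σᶠ-indicator (suc m) (suc a) true a<m =
  trans (Σᶠ-cong {m} λ j → cong (λ b → b2n (b ∧ true)) (suc-≟ (toℕ j)))
        (Σᶠ-indicator m a true λ e → ≤-pred (a<m e))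
  where
  suc-≟ : ∀ j → ⌊ suc a ≟ suc j ⌋ ≡ ⌊ a ≟ j ⌋
  suc-≟ j with a ≟ j
  ... | yes a≡j = isYes⁺ (suc a ≟ suc j) (cong suc a≡j)
  ... | no a≢j  = isNo⁺ (suc a ≟ suc j) (a≢j ∘ suc-injective)

-- Splitting a count over the values of a function

fibre : ∀ {n} → (Fin n → ℕ) → ℕ → (Fin n → Bool) → Fin n → Bool
fibre f j p v = ⌊ f v ≟ j ⌋ ∧ p v

-- Double counting. It is applied both to the levels `ℓ` and to the columns `c`, to compare sizes
-- layer by layer or column by column.
cnt-fibres : ∀ {n} (f : Fin n → ℕ) (p : Fin n → Bool) m → (∀ v → p v ≡ true → f v < m) →
  cnt p ≡ Σᶠ {m} (λ j → cnt (fibre f (toℕ j) p))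
cnt-fibres f p m f<m =
  trans (Σᶠ-cong λ v → ≡-sym (Σᶠ-indicator m (f v) (p v) (f<m v)))
        (Σᶠ-swap {m = m} λ v j → b2n (fibre f (toℕ j) p v))

-- Ranks within a subset

-- The number of elements of `p` before `u`. On `p` it is a bijection onto the numbers below
-- `cnt p`, as the next three lemmas show.
rank : ∀ {n} → (Fin n → Bool) → Fin n → ℕ
rank p zero    = 0
rank p (suc u) = b2n (p zero) + rank (p ∘ suc) u

rank-< : ∀ {n} (p : Fin n → Bool) u → p u ≡ true → rank p u < cnt p
rank-< p zero    pu rewrite pu = s≤s z≤n
rank-< p (suc u) pu = +-monoʳ-< (b2n (p zero)) (rank-< (p ∘ suc) u pu)

rank-injective : ∀ {n} (p : Fin n → Bool) u v → p u ≡ true → p v ≡ true →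
  rank p u ≡ rank p v → u ≡ v
rank-injective p zero    zero    _  _  _ = refl
rank-injective p zero    (suc v) pu _  e rewrite pu = contradiction e λ ()
rank-injective p (suc u) zero    _  pv e rewrite pv = contradiction e λ ()
rank-injective p (suc u) (suc v) pu pv e =
  cong suc (rank-injective (p ∘ suc) u v pu pv (+-cancelˡ-≡ (b2n (p zero)) _ _ e))

rank-surjective : ∀ {n} (p : Fin n → Bool) j → j < cnt p → ∃[ u ] p u ≡ true × rank p u ≡ j
rank-surjective {suc n} p j j< with p zero in p0
rank-surjective {suc n} p j j< | false =
  let u , pu , e = rank-surjective (p ∘ suc) j j< in
  suc u , pu , trans (cong (λ b → b2n b + rank (p ∘ suc) u) p0) e
rank-surjective {suc n} p zero    j< | true = zero , p0 , refl
rank-surjective {suc n} p (suc j) j< | true =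
  let u , pu , e = rank-surjective (p ∘ suc) j (≤-pred j<) in
  suc u , pu , trans (cong (λ b → b2n b + rank (p ∘ suc) u) p0) (cong suc e)

-- Subsets as Boolean predicates

∣∣≡cnt : ∀ {n} (S : Subset n) → ∣ S ∣ ≡ cnt (lookup S)
∣∣≡cnt []          = refl
∣∣≡cnt (true ∷ S)  = cong suc (∣∣≡cnt S)
∣∣≡cnt (false ∷ S) = ∣∣≡cnt S

∣tabulate∣ : ∀ {n} (p : Fin n → Bool) → ∣ tabulate p ∣ ≡ cnt p
∣tabulate∣ p = trans (∣∣≡cnt (tabulate p)) (Σᶠ-cong λ u → cong b2n (lookup∘tabulate p u))

∈-tabulate⁻ : ∀ {n} {p : Fin n → Bool} {u} → u ∈ tabulate p → p u ≡ true
∈-tabulate⁻ {p = p} {u} u∈ = trans (≡-sym (lookup∘tabulate p u)) ([]=⇒lookup u∈)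

-- Counting edges along an orientation

module _ {n} (G : Graph n) where

  private
    along : (Fin n → Fin n → Bool) → ℕ
    along o = Σᶠ λ u → cnt λ v → o u v ∧ adj G u v

    Orients : (Fin n → Fin n → Bool) → Set
    Orients o = ∀ u v → adj G u v ≡ true → b2n (o u v) + b2n (o v u) ≡ 1

    -- An orientation and its reverse together count each ordered adjacent pair once, so the double
    -- is the degree sum whichever orientation is chosen.
    along-double : ∀ o → Orients o → along o + along o ≡ Σᶠ λ u → cnt (adj G u)
    along-double o o-or = begin
      along o + along o ≡⟨ cong (along o +_) (Σᶠ-swap f) ⟩
      along o + Σᶠ (λ u → Σᶠ λ v → f v u) ≡⟨ Σᶠ-+ (λ u → Σᶠ (f u)) (λ u → Σᶠ λ v → f v u) ⟨
      Σᶠ (λ u → Σᶠ (f u) + Σᶠ λ v → f v u) ≡⟨ Σᶠ-cong (λ u → ≡-sym (Σᶠ-+ (f u) (λ v → f v u))) ⟩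
      Σᶠ (λ u → Σᶠ λ v → f u v + f v u) ≡⟨ Σᶠ-cong (λ u → Σᶠ-cong (pointwise u)) ⟩
      Σᶠ (λ u → cnt (adj G u)) ∎
      where
      open ≡-Reasoning
      f : Fin n → Fin n → ℕ
      f u v = b2n (o u v ∧ adj G u v)
      pointwise : ∀ u v → f u v + f v u ≡ b2n (adj G u v)
      -- Where the values of `o` contradict the orientation, the goal is the very equation that `h`
      -- yields.
      pointwise u v rewrite sym G v u with adj G u v | o u v | o v u | o-or u v
      ... | true  | true  | true  | h = h refl
      ... | true  | true  | false | h = refl
      ... | true  | false | true  | h = refl
      ... | true  | false | false | h = h refl
      ... | false | true  | true  | _ = refl
      ... | false | true  | false | _ = refl
      ... | false | false | true  | _ = refl
      ... | false | false | false | _ = refl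

    double-injective : ∀ a b → a + a ≡ b + b → a ≡ b
    double-injective a b e = *-cancelˡ-≡ a b 2
      (trans (cong (a +_) (+-identityʳ a)) (trans e (cong (b +_) (≡-sym (+-identityʳ b)))))

    <-orients : ∀ a b → a ≢ b → b2n ⌊ a <? b ⌋ + b2n ⌊ b <? a ⌋ ≡ 1
    <-orients a b a≢b with <-cmp a b
    ... | tri< a<b _ b≮a = cong₂ (λ x y → b2n x + b2n y) (isYes⁺ (a <? b) a<b) (isNo⁺ (b <? a) b≮a)
    ... | tri≈ _ a≡b _   = contradiction a≡b a≢b
    ... | tri> a≮b _ b<a = cong₂ (λ x y → b2n x + b2n y) (isNo⁺ (a <? b) a≮b) (isYes⁺ (b <? a) b<a)

  -- The index order behind `edges` and the order by level both orient every edge, so both counts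
  -- double to the degree sum.
  edges-by-level : (ℓ : Fin n → ℕ) → (∀ u v → adj G u v ≡ true → ℓ u ≢ ℓ v) →
    edges G ≡ Σᶠ λ u → cnt λ v → ⌊ ℓ v <? ℓ u ⌋ ∧ adj G u v
  edges-by-level ℓ ℓ-proper = double-injective _ _
    (trans (along-double (λ u v → ⌊ toℕ u <? toℕ v ⌋) λ u v uv →
             <-orients (toℕ u) (toℕ v) λ e → true≢false uv
               (trans (cong (adj G u) (≡-sym (toℕ-injective e))) (irrefl G u)))
           (≡-sym (along-double (λ u v → ⌊ ℓ v <? ℓ u ⌋) λ u v uv →
             <-orients (ℓ v) (ℓ u) (ℓ-proper u v uv ∘ ≡-sym))))

-- Maximum independent sets

module _ {n} (G : Graph n) where

  Ind : (Fin n → Bool) → Set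
  Ind p = ∀ u v → p u ≡ true → p v ≡ true → adj G u v ≡ false

  -- Maximum in size, and relative to `R`, so that the same notion applies to what remains after
  -- layers have been peeled off.
  record MaxInd (R I : Fin n → Bool) : Set where
    field
      sub : ∀ u → I u ≡ true → R u ≡ true
      ind : Ind I
      max : ∀ p → (∀ u → p u ≡ true → R u ≡ true) → Ind p → cnt p ≤ cnt I
  open MaxInd

  insert : (Fin n → Bool) → Fin n → Fin n → Bool
  insert I v u = I u ∨ ⌊ u ≟ᶠ v ⌋

  insert⁻ : ∀ I v u → insert I v u ≡ true → I u ≡ true ⊎ u ≡ v
  insert⁻ I v u h with I u
  ... | true  = inj₁ refl
  ... | false = inj₂ (isYes⁻ (u ≟ᶠ v) h)

  insert-self : ∀ I v → insert I v v ≡ true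
  insert-self I v with I v
  ... | true  = refl
  ... | false = isYes⁺ (v ≟ᶠ v) refl

  cnt-insert : ∀ I v → I v ≡ false → cnt I < cnt (insert I v)
  cnt-insert I v v∉ = Σᶠ-mono-< (λ u → b2n-mono (mono u)) v strict
    where
    mono : ∀ u → I u ≡ true → insert I v u ≡ true
    mono u e rewrite e = refl
    strict : b2n (I v) < b2n (insert I v v)
    strict rewrite insert-self I v | v∉ = s≤s z≤n

  Ind-insert : ∀ {I v} → Ind I → (∀ u → I u ≡ true → adj G v u ≡ false) → Ind (insert I v)
  Ind-insert {I} {v} indI h u w u∈ w∈ with insert⁻ I v u u∈ | insert⁻ I v w w∈
  ... | inj₁ u∈I  | inj₁ w∈I  = indI u w u∈I w∈I
  ... | inj₁ u∈I  | inj₂ refl = trans (sym G u v) (h u u∈I)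
  ... | inj₂ refl | inj₁ w∈I  = h w w∈I
  ... | inj₂ refl | inj₂ refl = irrefl G v

  -- Otherwise inserting `v` would give a larger independent set.
  MaxInd-neighbour : ∀ {R I} → MaxInd R I → ∀ v → R v ≡ true → I v ≡ false →
    ∃[ u ] I u ≡ true × adj G v u ≡ true
  MaxInd-neighbour {R} {I} M v v∈R v∉I
    with any? (λ u → (I u ≟ᵇ true) ×-dec (adj G v u ≟ᵇ true))
  ... | yes w = w
  ... | no ¬w = contradiction (cnt-insert I v v∉I) (≤⇒≯ (max M (insert I v) sub′
        (Ind-insert (ind M) λ u u∈I → not-true⇒false λ vu → ¬w (u , u∈I , vu))))
    where
    sub′ : ∀ u → insert I v u ≡ true → R u ≡ true
    sub′ u u∈ with insert⁻ I v u u∈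
    ... | inj₁ u∈I  = sub M u u∈I
    ... | inj₂ refl = v∈R

  maxInd : ∀ R → ∃ (MaxInd R)
  maxInd R = search n λ p _ _ → Σᶠ-≤1 λ u → b2n-≤1 (p u)
    where
    b2n-≤1 : ∀ b → b2n b ≤ 1
    b2n-≤1 true  = ≤-refl
    b2n-≤1 false = z≤n

    Good : (Fin n → Bool) → Set
    Good p = (∀ u → p u ≡ true → R u ≡ true) × Ind p

    good? : ∀ p → Dec (Good p)
    good? p = all? (λ u → (p u ≟ᵇ true) →-dec (R u ≟ᵇ true)) ×-dec
      all? (λ u → all? λ v → (p u ≟ᵇ true) →-dec ((p v ≟ᵇ true) →-dec (adj G u v ≟ᵇ false)))

    -- The size bound `m` descends from `n` until some independent subset of `R` attains it.
    search : ∀ m → (∀ p → (∀ u → p u ≡ true → R u ≡ true) → Ind p → cnt p ≤ m) → ∃ (MaxInd R)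
    search m bound with anySubset? (λ S → good? (lookup S) ×-dec (cnt (lookup S) ≟ m))
    ... | yes (S , (s , i) , refl) = lookup S , record { sub = s ; ind = i ; max = bound }
    search zero bound | no _ = (λ _ → false) , record
      { sub = λ _ () ; ind = λ _ _ ()
      ; max = λ p s i → ≤-trans (bound p s i) z≤n }
    -- The failed search ranged over `Subset`, so a predicate is tabulated before it is compared
    -- with the result.
    search (suc m) bound | no ¬S = search m λ p s i → ≤-pred (≤∧≢⇒< (bound p s i) λ e →
      ¬S (tabulate p , (good-tabulate p s i) ,
          trans (Σᶠ-cong λ u → cong b2n (lookup∘tabulate p u)) e))
      where
      good-tabulate : ∀ p → (∀ u → p u ≡ true → R u ≡ true) → Ind p → Good (lookup (tabulate p))
      good-tabulate p s i =
        (λ u u∈ → s u (trans (≡-sym (lookup∘tabulate p u)) u∈)) ,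
        (λ u v u∈ v∈ → i u v (trans (≡-sym (lookup∘tabulate p u)) u∈)
                             (trans (≡-sym (lookup∘tabulate p v)) v∈))

  -- Layers

  -- What peeling yields: `below` will bound the edges of `G` from below, and `shrinking` will make
  -- the columns of the compressed graph free of gaps.
  record Layering (R I : Fin n → Bool) : Set where
    field
      ℓ         : Fin n → ℕ
      bottom    : ∀ u → I u ≡ true → ℓ u ≡ 0
      bottom⁻   : ∀ u → R u ≡ true → ℓ u ≡ 0 → I u ≡ true
      layer-ind : ∀ u v → R u ≡ true → R v ≡ true → ℓ u ≡ ℓ v → adj G u v ≡ false
      below     : ∀ u j → R u ≡ true → j < ℓ u → ∃[ v ] R v ≡ true × ℓ v ≡ j × adj G u v ≡ true
      shrinking : ∀ j → cnt (fibre ℓ (suc j) R) ≤ cnt (fibre ℓ j R)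

  -- Induction on the number of vertices left: `I` becomes level 0, and the levels of the remainder
  -- are shifted up by one.
  layering : ∀ fuel {R I} → cnt R ≤ fuel → MaxInd R I → Layering R I
  layering zero {R} {I} R≤ M = record
    { ℓ = λ _ → 0 ; bottom = λ _ _ → refl ; bottom⁻ = λ u u∈ _ → contradiction u∈ (∉R u)
    ; layer-ind = λ u _ u∈ → contradiction u∈ (∉R u)
    ; below = λ u _ u∈ → contradiction u∈ (∉R u)
    ; shrinking = λ j → cnt-mono λ u u∈ → contradiction (proj₂ (∧⁻ {⌊ 0 ≟ suc j ⌋} u∈)) (∉R u) }
    where
    ∉R : ∀ u → R u ≢ true
    ∉R u u∈ = contradiction (≤-trans (cnt-≥1 {p = R} u u∈) R≤) λ ()
  layering (suc fuel) {R} {I} R≤ M = record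
    { ℓ = ℓ ; bottom = bot ; bottom⁻ = λ u _ → bot⁻ u
    ; layer-ind = lay ; below = bel ; shrinking = shr }
    where
    R′ : Fin n → Bool
    R′ u = R u ∧ not (I u)

    R′⁺ : ∀ u → R u ≡ true → I u ≡ false → R′ u ≡ true
    R′⁺ u u∈ u∉ = ∧⁺ u∈ (cong not u∉)

    split : cnt R ≡ cnt R′ + cnt I
    split = cnt-disjoint {p = R′} {q = I} pw
      where
      pw : ∀ u → b2n (R u) ≡ b2n (R′ u) + b2n (I u)
      pw u with R u in r | I u in i
      ... | true  | true  = refl
      ... | true  | false = refl
      ... | false | false = refl
      ... | false | true  = contradiction r (true≢false (sub M u i))

    -- If `I` is nonempty, removing it uses up a unit of fuel. If `I` is empty, so is `R′`, whose
    -- vertices would have a neighbour in `I`.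
    R′≤ : cnt R′ ≤ fuel
    R′≤ with cnt I in e
    ... | suc m = ≤-pred (≤-trans (≤-trans (≤-reflexive (≡-sym (+-comm (cnt R′) 1)))
                    (+-monoʳ-≤ (cnt R′) (s≤s z≤n)))
                    (subst (_≤ suc fuel) (trans split (cong (cnt R′ +_) e)) R≤))
    ... | zero  = subst (_≤ fuel) (≡-sym (cnt-empty empty)) z≤n
      where
      empty : ∀ u → R′ u ≢ true
      empty u u∈ =
        let u∈R , u∉I = ∧⁻ {R u} u∈
            w , w∈I , _ = MaxInd-neighbour M u u∈R (not-true⇒false λ u∈I → true≢false u∉I (cong not u∈I))
        in contradiction (subst (1 ≤_) e (cnt-≥1 {p = I} w w∈I)) λ ()

    I′ : Fin n → Bool
    I′ = proj₁ (maxInd R′)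

    rest : Layering R′ I′
    rest = layering fuel R′≤ (proj₂ (maxInd R′))

    module L = Layering rest

    level : Bool → ℕ → ℕ
    level true  _ = 0
    level false m = suc m

    ℓ : Fin n → ℕ
    ℓ u = level (I u) (L.ℓ u)

    bot : ∀ u → I u ≡ true → ℓ u ≡ 0
    bot u u∈ = cong (λ b → level b (L.ℓ u)) u∈

    bot⁻ : ∀ u → ℓ u ≡ 0 → I u ≡ true
    bot⁻ u e with I u
    ... | true = refl

    up : ∀ u → I u ≡ false → ℓ u ≡ suc (L.ℓ u)
    up u u∉ = cong (λ b → level b (L.ℓ u)) u∉

    up⁻ : ∀ u j → ℓ u ≡ suc j → I u ≡ false × L.ℓ u ≡ j
    up⁻ u j e with I u
    ... | false = refl , suc-injective e

    R′⁻ : ∀ u → R′ u ≡ true → R u ≡ true × I u ≡ false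
    R′⁻ u u∈ with R u | I u
    ... | true | false = refl , refl

    lay : ∀ u v → R u ≡ true → R v ≡ true → ℓ u ≡ ℓ v → adj G u v ≡ false
    lay u v u∈ v∈ e with ℓ v in ev
    ... | zero  = ind M u v (bot⁻ u e) (bot⁻ v ev)
    ... | suc j = let u∉ , eu = up⁻ u j e ; v∉ , ev′ = up⁻ v j ev in
      L.layer-ind u v (R′⁺ u u∈ u∉) (R′⁺ v v∈ v∉) (trans eu (≡-sym ev′))

    bel : ∀ u j → R u ≡ true → j < ℓ u → ∃[ v ] R v ≡ true × ℓ v ≡ j × adj G u v ≡ true
    bel u j u∈ j< with ℓ u in eu
    bel u zero u∈ j< | suc m =
      let v , v∈I , uv = MaxInd-neighbour M u u∈ (proj₁ (up⁻ u m eu))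
      in v , sub M v v∈I , bot v v∈I , uv
    bel u (suc j) u∈ (s≤s j<) | suc m =
      let u∉ , eu′ = up⁻ u m eu
          v , v∈R′ , ev , uv = L.below u j (R′⁺ u u∈ u∉) (subst (j <_) (≡-sym eu′) j<)
          v∈R , v∉I = R′⁻ v v∈R′
      in v , v∈R , trans (up v v∉I) (cong suc ev) , uv

    fib : ∀ j u → fibre ℓ (suc j) R u ≡ true → fibre L.ℓ j R′ u ≡ true
    fib j u h = let e , u∈ = ∧⁻ {⌊ ℓ u ≟ suc j ⌋} h
                    u∉ , e′ = up⁻ u j (isYes⁻ (ℓ u ≟ suc j) e)
                in ∧⁺ (isYes⁺ (L.ℓ u ≟ j) e′) (R′⁺ u u∈ u∉)

    fib⁻ : ∀ j u → fibre L.ℓ j R′ u ≡ true → fibre ℓ (suc j) R u ≡ true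
    fib⁻ j u h = let e , u∈ = ∧⁻ {⌊ L.ℓ u ≟ j ⌋} h
                     u∈R , u∉ = R′⁻ u u∈
                 in ∧⁺ (isYes⁺ (ℓ u ≟ suc j) (trans (up u u∉) (cong suc (isYes⁻ (L.ℓ u ≟ j) e)))) u∈R

    shr : ∀ j → cnt (fibre ℓ (suc j) R) ≤ cnt (fibre ℓ j R)
    -- Level 1 is an independent subset of `R`, hence no larger than the maximum one `I`, which lies
    -- in level 0.
    shr zero = ≤-trans
      (max M (fibre ℓ 1 R) (λ u h → proj₂ (∧⁻ {⌊ ℓ u ≟ 1 ⌋} h)) λ u v hu hv →
        let eu , u∈ = ∧⁻ {⌊ ℓ u ≟ 1 ⌋} hu ; ev , v∈ = ∧⁻ {⌊ ℓ v ≟ 1 ⌋} hv in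
        lay u v u∈ v∈ (trans (isYes⁻ (ℓ u ≟ 1) eu) (≡-sym (isYes⁻ (ℓ v ≟ 1) ev))))
      (cnt-mono λ u u∈ → ∧⁺ (isYes⁺ (ℓ u ≟ 0) (bot u u∈)) (sub M u u∈))
    shr (suc j) = ≤-trans (cnt-mono (fib (suc j))) (≤-trans (L.shrinking j) (cnt-mono (fib⁻ j)))

all : ∀ {n} → Fin n → Bool
all _ = true

-- Compression to a union of cliques

module Compression {n} (G : Graph n) {J : Fin n → Bool} (M : MaxInd G all J) where

  open MaxInd M
  open Layering (layering G (cnt {n} all) ≤-refl M)

  layer : ℕ → Fin n → Bool
  layer j = fibre ℓ j all

  layer⁺ : ∀ {u j} → ℓ u ≡ j → layer j u ≡ true
  layer⁺ {u} {j} e = ∧⁺ (isYes⁺ (ℓ u ≟ j) e) refl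

  layer⁻ : ∀ {u j} → layer j u ≡ true → ℓ u ≡ j
  layer⁻ {u} {j} h = isYes⁻ (ℓ u ≟ j) (proj₁ (∧⁻ {⌊ ℓ u ≟ j ⌋} h))

  layers-antitone : ∀ i d → cnt (layer (d + i)) ≤ cnt (layer i)
  layers-antitone i zero    = ≤-refl
  layers-antitone i (suc d) = ≤-trans (shrinking (d + i)) (layers-antitone i d)

  -- The column of `u`, given by its position in its own layer. The columns become the cliques of
  -- `H`.
  c : Fin n → ℕ
  c u = rank (layer (ℓ u)) u

  c-injective : ∀ {u v} → ℓ u ≡ ℓ v → c u ≡ c v → u ≡ v
  c-injective {u} {v} ℓ≡ c≡ = rank-injective (layer (ℓ v)) u v (layer⁺ ℓ≡) (layer⁺ refl)
    (trans (cong (λ j → rank (layer j) u) (≡-sym ℓ≡)) c≡)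

  c-<layer : ∀ u j → j ≤ ℓ u → c u < cnt (layer j)
  c-<layer u j j≤ = <-≤-trans (rank-< (layer (ℓ u)) u (layer⁺ refl))
    (subst (λ i → cnt (layer i) ≤ cnt (layer j)) (m∸n+n≡m j≤) (layers-antitone j (ℓ u ∸ j)))

  c-<J : ∀ u → c u < cnt J
  c-<J u = <-≤-trans (c-<layer u 0 z≤n) (cnt-mono λ v h → bottom⁻ v refl (layer⁻ h))

  -- Columns have no gaps: lower layers are at least as large, so the rank `c u` occurs in each of
  -- them.
  c-below : ∀ u j → j ≤ ℓ u → ∃[ v ] ℓ v ≡ j × c v ≡ c u
  c-below u j j≤ =
    let v , h , e = rank-surjective (layer j) (c u) (c-<layer u j j≤) in
    v , layer⁻ h , trans (cong (λ i → rank (layer i) v) (layer⁻ h)) e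

  H : Graph n
  H = record
    { adj = λ u v → not ⌊ u ≟ᶠ v ⌋ ∧ ⌊ c u ≟ c v ⌋
    ; sym = λ u v → cong₂ (λ a b → not a ∧ b)
        (isYes-cong (u ≟ᶠ v) (v ≟ᶠ u) ≡-sym ≡-sym)
        (isYes-cong (c u ≟ c v) (c v ≟ c u) ≡-sym ≡-sym)
    ; irrefl = λ u → cong (λ b → not b ∧ ⌊ c u ≟ c u ⌋) (isYes⁺ (u ≟ᶠ u) refl) }
    where
    isYes-cong : ∀ {A B : Set} (a? : Dec A) (b? : Dec B) → (A → B) → (B → A) → ⌊ a? ⌋ ≡ ⌊ b? ⌋
    isYes-cong (yes a) b? f g = ≡-sym (isYes⁺ b? (f a))
    isYes-cong (no ¬a) b? f g = ≡-sym (isNo⁺ b? (¬a ∘ g))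

  H-adj⁺ : ∀ {u v} → u ≢ v → c u ≡ c v → adj H u v ≡ true
  H-adj⁺ {u} {v} u≢v e = ∧⁺ (cong not (isNo⁺ (u ≟ᶠ v) u≢v)) (isYes⁺ (c u ≟ c v) e)

  H-adj⁻ : ∀ u v → adj H u v ≡ true → u ≢ v × c u ≡ c v
  H-adj⁻ u v h = let a , b = ∧⁻ {not ⌊ u ≟ᶠ v ⌋} h in
    (λ u≡v → true≢false a (cong not (isYes⁺ (u ≟ᶠ v) u≡v))) , isYes⁻ (c u ≟ c v) b

  -- Comparing the edges of `H` and `G`

  lower : Graph n → Fin n → Fin n → Bool
  lower K u v = ⌊ ℓ v <? ℓ u ⌋ ∧ adj K u v

  lower-fibres : ∀ K u → cnt (lower K u) ≡ Σᶠ {ℓ u} (λ j → cnt (fibre ℓ (toℕ j) (lower K u)))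
  lower-fibres K u = cnt-fibres ℓ (lower K u) (ℓ u) λ v h →
    isYes⁻ (ℓ v <? ℓ u) (proj₁ (∧⁻ {⌊ ℓ v <? ℓ u ⌋} h))

  fibre-lower⁺ : ∀ K u v j → j < ℓ u → ℓ v ≡ j → adj K u v ≡ true → fibre ℓ j (lower K u) v ≡ true
  fibre-lower⁺ K u v j j< e uv =
    ∧⁺ (isYes⁺ (ℓ v ≟ j) e) (∧⁺ (isYes⁺ (ℓ v <? ℓ u) (subst (_< ℓ u) (≡-sym e) j<)) uv)

  fibre-lower⁻ : ∀ K u v j → fibre ℓ j (lower K u) v ≡ true → ℓ v ≡ j × adj K u v ≡ true
  fibre-lower⁻ K u v j h = let a , b = ∧⁻ {⌊ ℓ v ≟ j ⌋} h in
    isYes⁻ (ℓ v ≟ j) a , proj₂ (∧⁻ {⌊ ℓ v <? ℓ u ⌋} b)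

  -- The neighbours of `u` in `H` share its column, and a column meets a layer at most once.
  H-fibre-≤1 : ∀ u j → cnt (fibre ℓ j (lower H u)) ≤ 1
  H-fibre-≤1 u j = cnt-≤1 λ v w hv hw →
    let ev , uv = fibre-lower⁻ H u v j hv ; ew , uw = fibre-lower⁻ H u w j hw in
    c-injective (trans ev (≡-sym ew)) (trans (≡-sym (proj₂ (H-adj⁻ u v uv))) (proj₂ (H-adj⁻ u w uw)))

  -- In each lower layer `u` has at most one neighbour in `H`, but at least one in `G` by `below`.
  fibre-≤ : ∀ u (j : Fin (ℓ u)) → cnt (fibre ℓ (toℕ j) (lower H u)) ≤ cnt (fibre ℓ (toℕ j) (lower G u))
  fibre-≤ u j = let v , _ , e , uv = below u (toℕ j) refl (toℕ<n j) in
    ≤-trans (H-fibre-≤1 u (toℕ j))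
            (cnt-≥1 {p = fibre ℓ (toℕ j) (lower G u)} v (fibre-lower⁺ G u v (toℕ j) (toℕ<n j) e uv))

  lower-≤ : ∀ u → cnt (lower H u) ≤ cnt (lower G u)
  lower-≤ u rewrite lower-fibres H u | lower-fibres G u = Σᶠ-mono-≤ (fibre-≤ u)

  -- Both `x` and `y` lie in layer 0, which therefore contributes at least two for `G` and at most
  -- one for `H`; no other layer makes up for this.
  lower-< : ∀ u x y → J u ≡ false → J x ≡ true → J y ≡ true → x ≢ y →
    adj G u x ≡ true → adj G u y ≡ true → cnt (lower H u) < cnt (lower G u)
  lower-< u x y u∉ x∈ y∈ x≢y ux uy rewrite lower-fibres H u | lower-fibres G u =
    Σᶠ-mono-< (fibre-≤ u) (fromℕ< 0<ℓ)
      (subst (λ j → cnt (fibre ℓ j (lower H u)) < cnt (fibre ℓ j (lower G u)))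
             (≡-sym (toℕ-fromℕ< 0<ℓ))
             (≤-<-trans (H-fibre-≤1 u 0)
               (cnt-≥2 {p = fibre ℓ 0 (lower G u)} x y x≢y
                 (fibre-lower⁺ G u x 0 0<ℓ (bottom x x∈) ux)
                 (fibre-lower⁺ G u y 0 0<ℓ (bottom y y∈) uy))))
    where
    0<ℓ : 0 < ℓ u
    0<ℓ = n≢0⇒n>0 λ e → true≢false (bottom⁻ u refl e) u∉

  edges-H : edges H ≡ Σᶠ λ u → cnt (lower H u)
  edges-H = edges-by-level H ℓ λ u v uv e →
    let u≢v , c≡ = H-adj⁻ u v uv in u≢v (c-injective e c≡)

  edges-G : edges G ≡ Σᶠ λ u → cnt (lower G u)
  edges-G = edges-by-level G ℓ λ u v uv e → true≢false uv (layer-ind u v refl refl e)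

  edges-< : ∀ u x y → J u ≡ false → J x ≡ true → J y ≡ true → x ≢ y →
    adj G u x ≡ true → adj G u y ≡ true → edges H < edges G
  edges-< u x y u∉ x∈ y∈ x≢y ux uy rewrite edges-H | edges-G =
    Σᶠ-mono-< lower-≤ u (lower-< u x y u∉ x∈ y∈ x≢y ux uy)

  -- Independence number of `H`

  -- The vertices of `J` form layer 0 and so lie in distinct columns. Conversely, an independent set
  -- takes at most one vertex from each of the `cnt J` columns.
  H-independenceNumber : IndependenceNumber H (cnt J)
  H-independenceNumber =
    (tabulate J ,
      (λ u v u∈ v∈ → not-true⇒false λ uv →
        let u≢v , c≡ = H-adj⁻ u v uv in
        u≢v (c-injective (trans (bottom u (∈-tabulate⁻ u∈)) (≡-sym (bottom v (∈-tabulate⁻ v∈)))) c≡)) ,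
      ∣tabulate∣ J) ,
    λ I indI → subst (_≤ cnt J)
      (trans (≡-sym (cnt-fibres c (lookup I) (cnt J) λ v _ → c-<J v)) (≡-sym (∣∣≡cnt I)))
      (Σᶠ-≤1 {cnt J} λ j → cnt-≤1 (unique I indI (toℕ j)))
    where
    unique : ∀ I → IsIndependent H I → ∀ j u v →
      fibre c j (lookup I) u ≡ true → fibre c j (lookup I) v ≡ true → u ≡ v
    unique I indI j u v hu hv with u ≟ᶠ v
    ... | yes u≡v = u≡v
    ... | no u≢v =
      let a , u∈ = ∧⁻ {⌊ c u ≟ j ⌋} hu ; b , v∈ = ∧⁻ {⌊ c v ≟ j ⌋} hv in
      contradiction (indI u v (lookup⇒[]= u I u∈) (lookup⇒[]= v I v∈))
        (true≢false (H-adj⁺ u≢v (trans (isYes⁻ (c u ≟ j) a) (≡-sym (isYes⁻ (c v ≟ j) b)))))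

  -- Cliques in `H`

  under : ℕ → Fin n → Bool
  under s v = ⌊ ℓ v <? s ⌋

  -- If column `x` reaches level `s` or higher, it has a vertex on every level below `s`, hence at
  -- least `s` of them. Otherwise the whole column lies in `under s`.
  column-≤ : ∀ s x (p : Fin n → Bool) → cnt (fibre c x p) ≤ s →
    cnt (fibre c x p) ≤ cnt (fibre c x (under s))
  column-≤ s x p p≤s with any? (λ u → (c u ≟ x) ×-dec (s ≤? ℓ u))
  ... | no ¬tall = cnt-mono λ u h → let a , _ = ∧⁻ {⌊ c u ≟ x ⌋} h in
          ∧⁺ a (isYes⁺ (ℓ u <? s) (≰⇒> λ s≤ → ¬tall (u , isYes⁻ (c u ≟ x) a , s≤)))
  ... | yes (u , refl , s≤) = ≤-trans p≤s
          (subst (s ≤_) (≡-sym (cnt-fibres ℓ q s λ v h → isYes⁻ (ℓ v <? s) (proj₂ (∧⁻ {⌊ c v ≟ c u ⌋} h))))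
            (Σᶠ-≥1 {s} λ j → let v , ℓ≡ , c≡ = c-below u (toℕ j) (≤-trans (<⇒≤ (toℕ<n j)) s≤) in
              cnt-≥1 {p = fibre ℓ (toℕ j) q} v (∧⁺ (isYes⁺ (ℓ v ≟ toℕ j) ℓ≡)
                (∧⁺ (isYes⁺ (c v ≟ c u) c≡)
                  (isYes⁺ (ℓ v <? s) (subst (_< s) (≡-sym ℓ≡) (toℕ<n j)))))))
    where
    q : Fin n → Bool
    q = fibre c (c u) (under s)

  -- A clique takes at most one vertex from each of the `s` independent layers.
  under-clique-≤ : ∀ s T → IsClique G T → (∀ u → u ∈ T → ℓ u < s) → ∣ T ∣ ≤ s
  under-clique-≤ s T clq T<s = subst (_≤ s)
    (trans (≡-sym (cnt-fibres ℓ (lookup T) s λ v v∈ → T<s v (lookup⇒[]= v T v∈))) (≡-sym (∣∣≡cnt T)))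
    (Σᶠ-≤1 {s} λ j → cnt-≤1 (unique (toℕ j)))
    where
    unique : ∀ j u v → fibre ℓ j (lookup T) u ≡ true → fibre ℓ j (lookup T) v ≡ true → u ≡ v
    unique j u v hu hv with u ≟ᶠ v
    ... | yes u≡v = u≡v
    ... | no u≢v =
      let a , u∈ = ∧⁻ {⌊ ℓ u ≟ j ⌋} hu ; b , v∈ = ∧⁻ {⌊ ℓ v ≟ j ⌋} hv in
      contradiction (layer-ind u v refl refl (trans (isYes⁻ (ℓ u ≟ j) a) (≡-sym (isYes⁻ (ℓ v ≟ j) b))))
        (true≢false (clq u v (lookup⇒[]= u T u∈) (lookup⇒[]= v T v∈) u≢v))

  -- Some column holds at least `suc s` vertices of `S`, which form a clique in `H`; otherwise `G`
  -- would violate its own clique condition.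
  H-NKT : ∀ {k s} → IsNKT G k (suc s) → IsNKT H k (suc s)
  H-NKT {k} {s} nkt S ∣S∣≡k with any? {n = cnt J} (λ x → suc s ≤? cnt (fibre c (toℕ x) (lookup S)))
  ... | yes (x , big) =
    let q , q⊆ , q≡ = cnt-shrink (fibre c (toℕ x) (lookup S)) (suc s) big
        col : ∀ {u} → u ∈ tabulate q → c u ≡ toℕ x × lookup S u ≡ true
        col {u} u∈ = let a , b = ∧⁻ {⌊ c u ≟ toℕ x ⌋} (q⊆ u (∈-tabulate⁻ u∈)) in
          isYes⁻ (c u ≟ toℕ x) a , b
    in tabulate q , (λ {u} u∈ → lookup⇒[]= u S (proj₂ (col u∈))) , trans (∣tabulate∣ q) q≡ ,
       λ u v u∈ v∈ u≢v → H-adj⁺ u≢v (trans (proj₁ (col u∈)) (≡-sym (proj₁ (col v∈))))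
  ... | no ¬big =
    -- With at most `s` vertices of `S` per column, `under s` has at least `k` vertices. Any `k` of
    -- them contain a clique of `G` on `suc s` vertices, too many for `s` layers.
    let q , q⊆ , q≡ = cnt-shrink (under s) k k≤
        T , T⊆ , T≡ , clq = nkt (tabulate q) (trans (∣tabulate∣ q) q≡)
    in contradiction
         (under-clique-≤ s T clq λ u u∈ → isYes⁻ (ℓ u <? s) (q⊆ u (∈-tabulate⁻ (T⊆ u∈))))
         (<⇒≱ (≤-reflexive (≡-sym T≡)))
    where
    k≤ : k ≤ cnt (under s)
    k≤ = begin
      k ≡⟨ ∣S∣≡k ⟨
      ∣ S ∣ ≡⟨ ∣∣≡cnt S ⟩
      cnt (lookup S) ≡⟨ cnt-fibres c (lookup S) (cnt J) (λ v _ → c-<J v) ⟩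
      Σᶠ {cnt J} (λ x → cnt (fibre c (toℕ x) (lookup S)))
        ≤⟨ Σᶠ-mono-≤ {cnt J} (λ x → column-≤ s (toℕ x) (lookup S) (≤-pred (≰⇒> λ b → ¬big (x , b)))) ⟩
      Σᶠ {cnt J} (λ x → cnt (fibre c (toℕ x) (under s)))
        ≡⟨ cnt-fibres c (under s) (cnt J) (λ v _ → c-<J v) ⟨
      cnt (under s) ∎
      where open ≤-Reasoning

-- Exchange in maximum independent sets with unique neighbours

module Exchange {n} (G : Graph n)
  (unique : ∀ {J} → MaxInd G all J → ∀ u x y → J u ≡ false → J x ≡ true → J y ≡ true →
            adj G u x ≡ true → adj G u y ≡ true → x ≡ y) where

  open MaxInd

  remove : (Fin n → Bool) → Fin n → Fin n → Bool
  remove J x u = J u ∧ not ⌊ u ≟ᶠ x ⌋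

  remove⁻ : ∀ J x u → remove J x u ≡ true → J u ≡ true × u ≢ x
  remove⁻ J x u h = let a , b = ∧⁻ {J u} h in
    a , λ u≡x → true≢false b (cong not (isYes⁺ (u ≟ᶠ x) u≡x))

  cnt-remove : ∀ J x → cnt J ≤ suc (cnt (remove J x))
  cnt-remove J x = ≤-trans (Σᶠ-mono-≤ pw) (≤-trans (≤-reflexive (Σᶠ-+ (λ u → b2n ⌊ u ≟ᶠ x ⌋) _))
    (+-monoˡ-≤ _ (cnt-≤1 λ u v hu hv →
      trans (isYes⁻ (u ≟ᶠ x) hu) (≡-sym (isYes⁻ (v ≟ᶠ x) hv)))))
    where
    pw : ∀ u → b2n (J u) ≤ b2n ⌊ u ≟ᶠ x ⌋ + b2n (remove J x u)
    pw u with J u | ⌊ u ≟ᶠ x ⌋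
    ... | true  | true  = ≤-refl
    ... | true  | false = ≤-refl
    ... | false | _     = z≤n

  exchange : (Fin n → Bool) → Fin n → Fin n → Fin n → Bool
  exchange J x y = insert G (remove J x) y

  -- By `unique`, `x` is the only neighbour of `y` in `J`, so the swap keeps independence.
  MaxInd-exchange : ∀ {J} → MaxInd G all J → ∀ x y → J x ≡ true → J y ≡ false →
    adj G y x ≡ true → MaxInd G all (exchange J x y)
  MaxInd-exchange {J} M x y x∈ y∉ yx = record
    { sub = λ _ _ → refl
    ; ind = Ind-insert G
        (λ u v u∈ v∈ → ind M u v (proj₁ (remove⁻ J x u u∈)) (proj₁ (remove⁻ J x v v∈)))
        (λ u u∈ → not-true⇒false λ yu → let u∈J , u≢x = remove⁻ J x u u∈ in
          u≢x (unique M y u x y∉ u∈J x∈ yu yx))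
    -- Removing `x` costs at most one vertex, and inserting `y`, which is not in `J`, regains it.
    ; max = λ p s i → ≤-trans (max M p s i)
        (≤-trans (cnt-remove J x) (cnt-insert G (remove J x) y (cong (_∧ not ⌊ y ≟ᶠ x ⌋) y∉))) }

  -- If an arbitrary maximum independent set misses `v`, a neighbour of `v` in it can be exchanged
  -- for `v`.
  MaxInd-through : ∀ v → ∃[ J ] MaxInd G all J × J v ≡ true
  MaxInd-through v with maxInd G all
  ... | J , M with J v in v?
  ...   | true  = J , M , v?
  ...   | false = let x , x∈ , vx = MaxInd-neighbour G M v refl v? in
    exchange J x v , MaxInd-exchange M x v x∈ v? vx , insert-self G (remove J x) v

  -- In J − b + a the vertex d must have a neighbour; if it is not a, then it
  -- is a second neighbour of d in J besides b.
  adj-trans : ∀ a b d → a ≢ d → adj G a b ≡ true → adj G b d ≡ true → adj G a d ≡ true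
  adj-trans a b d a≢d ab bd with adj G a d ≟ᵇ true | MaxInd-through b
  ... | yes ad | _ = ad
  ... | no ¬ad | J , M , b∈ = contradiction neighbour no-neighbour
    where
    db : adj G d b ≡ true
    db = trans (sym G d b) bd
    outside : ∀ v → adj G v b ≡ true → J v ≡ false
    outside v vb = not-true⇒false λ v∈ → true≢false vb (ind M v b v∈ b∈)
    J′ : Fin n → Bool
    J′ = exchange J b a
    d∉J′ : J′ d ≡ false
    d∉J′ rewrite outside d db = isNo⁺ (d ≟ᶠ a) (a≢d ∘ ≡-sym)
    neighbour : ∃[ y ] J′ y ≡ true × adj G d y ≡ true
    neighbour = MaxInd-neighbour G (MaxInd-exchange M b a b∈ (outside a ab) ab) d refl d∉J′
    no-neighbour : ¬ (∃[ y ] J′ y ≡ true × adj G d y ≡ true)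
    no-neighbour (y , y∈ , dy) with insert⁻ G (remove J b) a y y∈
    ... | inj₁ h    = let y∈J , y≢b = remove⁻ J b y h in y≢b (unique M d y b (outside d db) y∈J b∈ dy db)
    ... | inj₂ refl = ¬ad (trans (sym G a d) dy)

-- From transitive adjacency to a labelling by cliques

least : ∀ {n} {P : Fin n → Set} → (∀ i → Dec (P i)) → ∀ i → P i →
  ∃[ w ] P w × (∀ w′ → P w′ → toℕ w ≤ toℕ w′)
least {suc n} P? i Pi with P? zero
least P? i Pi | yes P0 = zero , P0 , λ _ _ → z≤n
least P? zero Pi | no ¬P0 = contradiction Pi ¬P0
least P? (suc i) Pi | no ¬P0 =
  let w , Pw , w≤ = least (P? ∘ suc) i Pi in
  suc w , Pw , λ { zero P0 → contradiction P0 ¬P0 ; (suc w′) Pw′ → s≤s (w≤ w′ Pw′) }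

-- Each vertex is labelled by the least vertex of its closed neighbourhood.

module _ {n} (G : Graph n)
  (adj-trans : ∀ a b d → a ≢ d → adj G a b ≡ true → adj G b d ≡ true → adj G a d ≡ true) where

  private
    -- Adjacency is transitive only between distinct ends; its reflexive closure is an equivalence
    -- relation.
    _~_ : Fin n → Fin n → Set
    u ~ v = u ≡ v ⊎ adj G u v ≡ true

    ~-sym : ∀ {u v} → u ~ v → v ~ u
    ~-sym (inj₁ e) = inj₁ (≡-sym e)
    ~-sym {u} {v} (inj₂ uv) = inj₂ (trans (sym G v u) uv)

    ~-trans : ∀ {u v w} → u ~ v → v ~ w → u ~ w
    ~-trans (inj₁ refl) q = q
    ~-trans p (inj₁ refl) = p
    ~-trans {u} {v} {w} (inj₂ p) (inj₂ q) with u ≟ᶠ w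
    ... | yes e = inj₁ e
    ... | no ne = inj₂ (adj-trans u v w ne p q)

    Label : Fin n → Fin n → Set
    Label u w = u ~ w × (∀ w′ → u ~ w′ → toℕ w ≤ toℕ w′)

    label : ∀ u → ∃ (Label u)
    label u = least (λ w → (u ≟ᶠ w) ⊎-dec (adj G u w ≟ᵇ true)) u (inj₁ refl)

  transitive⇒cliques : IsDisjointUnionOfCliques G
  transitive⇒cliques = (proj₁ ∘ label) , λ u v u≢v → mk⇔ (same u v) (adjacent u v u≢v)
    where
    same : ∀ u v → adj G u v ≡ true → proj₁ (label u) ≡ proj₁ (label v)
    same u v uv =
      let x , ux , x≤ = label u ; y , vy , y≤ = label v in
      -- Each of the two labels lies in the closed neighbourhood of the other end, so neither
      -- exceeds the other.
      toℕ-injective (≤-antisym (x≤ y (~-trans (inj₂ uv) vy)) (y≤ x (~-trans (~-sym (inj₂ uv)) ux)))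
    adjacent : ∀ u v → u ≢ v → proj₁ (label u) ≡ proj₁ (label v) → adj G u v ≡ true
    adjacent u v u≢v e with ~-trans (proj₁ (proj₂ (label u)))
                                    (subst (_~ v) (≡-sym e) (~-sym (proj₁ (proj₂ (label v)))))
    ... | inj₁ u≡v = contradiction u≡v u≢v
    ... | inj₂ uv  = uv

-- Unique neighbours from minimality

theorem4 : (n k t r : ℕ) → 1 ≤ t → t ≤ k → k ≤ n → 1 ≤ r →
    (G : Graph n) → IsMinNKTR G k t r → IsDisjointUnionOfCliques G
theorem4 n k (suc s) r _ _ _ _ G ((nkt , (I , indI , ∣I∣≡r) , α≤r) , minimal) =
  transitive⇒cliques G (Exchange.adj-trans G unique)
  where
  -- This turns the independence number `cnt J` of the compressed graph into `r`, so that `minimal`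
  -- applies to it.
  cnt≡r : ∀ {J} → MaxInd G all J → cnt J ≡ r
  cnt≡r {J} M = ≤-antisym
    (subst (_≤ r) (∣tabulate∣ J) (α≤r (tabulate J)
      λ u v u∈ v∈ → MaxInd.ind M u v (∈-tabulate⁻ u∈) (∈-tabulate⁻ v∈)))
    (subst (_≤ cnt J) (trans (≡-sym (∣∣≡cnt I)) ∣I∣≡r)
      (MaxInd.max M (lookup I) (λ _ _ → refl)
        λ u v u∈ v∈ → indI u v (lookup⇒[]= u I u∈) (lookup⇒[]= v I v∈)))

  unique : ∀ {J} → MaxInd G all J → ∀ u x y → J u ≡ false → J x ≡ true → J y ≡ true →
    adj G u x ≡ true → adj G u y ≡ true → x ≡ y
  unique {J} M u x y u∉ x∈ y∈ ux uy with x ≟ᶠ y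
  ... | yes x≡y = x≡y
  -- Two neighbours of `u` in `J` would give the compression along `J` fewer edges than `G`.
  ... | no x≢y  = contradiction (edges-< u x y u∉ x∈ y∈ x≢y ux uy)
    (≤⇒≯ (minimal H (H-NKT nkt , subst (IndependenceNumber H) (cnt≡r M) H-independenceNumber)))
    where open Compression G M
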